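{- Let $2\le d\le n-1$ and let $\mathcal{F}\subseteq 2^{[n]}$, with dual $\mathcal{G}$. Then $\mathcal{F}$ solves Model $2_d''$ if and only if $\mathcal{G}$ is $d$-union-free and $\mathcal{G}^d$ is Sperner and intersection cancellative.
   Context: $[n]=\{1,\dots,n\}$, and for $a\in[n]$, $\mathcal{F}_a=\{F\in\mathcal{F}: a\in F\}$. Setting (non-adaptive group testing): exactly $d$ elements of $[n]$ are defective, and all elements know $n$ and $d$. A family $\mathcal{F}\subseteq 2^{[n]}$ of queries is asked; if $D$ is the set of defectives, the answer to $F\in\mathcal{F}$ is YES if $F\cap D\ne\emptyset$ and NO otherwise. Each element knows exactly the queries containing it and their answers; a group $X$ of elements sharing information knows exactly the queries $F\in\mathcal{F}$ with $F\cap X\neq\emptyset$ and their answers. $\mathcal{F}$ is $d$-separating if for any two different $d$-element sets $X_1,X_2\subseteq[n]$ there is $F\in\mathcal{F}$ that intersects exactly one of $X_1,X_2$. $\mathcal{F}$ solves Model $2_d''$ if $\mathcal{F}$ is $d$-separating and any $d$ elements together always know who the defectives are, i.e. for every $d$-element $X\subseteq[n]$ and any two different $d$-element sets $D,D'\subseteq[n]$ there is $F\in\mathcal{F}$ with $F\cap X\ne\emptyset$ that intersects exactly one of $D,D'$. The dual of $\mathcal{F}$ is the indexed family $\mathcal{G}=(\mathcal{F}_a)_{a\in[n]}$ of subsets of the underlying set $\mathcal{F}$. It is $d$-union-free if for any two different $d$-element sets $X,Y\subseteq[n]$ we have $\bigcup_{a\in X}\mathcal{F}_a\neq\bigcup_{a\in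 Y}\mathcal{F}_a$. Put $\mathcal{G}^d=\{\bigcup_{a\in X}\mathcal{F}_a: X\subseteq[n],|X|=d\}$. A family $\mathcal{H}$ of sets is Sperner if there are no two different $H_1,H_2\in\mathcal{H}$ with $H_1\subseteq H_2$; it is intersection cancellative if there are no three pairwise different $H_1,H_2,H_3\in\mathcal{H}$ with $H_1\cap H_2=H_1\cap H_3$. -}

module Defs where

open import Data.Fin using (Fin)
open import Data.Fin.Subset as Sub using (Subset; Nonempty; ∣_∣)
open import Data.Nat using (ℕ)
open import Data.Product using (∃; ∃-syntax; _×_; proj₁)
open import Data.Sum using (_⊎_)
open import Function using (_∘_)
open import Level using (0ℓ)
open import Relation.Binary.PropositionalEquality using (_≡_; _≢_)
open import Relation.Nullary using (¬_)
open import Relation.Unary using (Pred; _∈_; _⊆_; _∩_; _≐_; ⋃)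

private
  variable
    n : ℕ
    A : Set

-- [n] is Fin n, its subsets are Subset n, and a family of queries is a
-- predicate on Subset n.
Family : ℕ → Set₁
Family n = Pred (Subset n) 0ℓ

-- The answer to the query F is YES when D is the set of defectives.
Meets : Subset n → Subset n → Set
Meets F D = Nonempty (F Sub.∩ D)

MeetsExactlyOne : Subset n → Subset n → Subset n → Set
MeetsExactlyOne F D D′ =
  (Meets F D × ¬ Meets F D′) ⊎ (¬ Meets F D × Meets F D′)

Separating : ℕ → Family n → Set
Separating d 𝓕 = ∀ X₁ X₂ → ∣ X₁ ∣ ≡ d → ∣ X₂ ∣ ≡ d → X₁ ≢ X₂ →
  ∃[ F ] F ∈ 𝓕 × MeetsExactlyOne F X₁ X₂

-- Model 2″_d: the elements of X jointly see exactly the queries meeting X.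
SolvesModel2″ : ℕ → Family n → Set
SolvesModel2″ d 𝓕 = Separating d 𝓕 ×
  (∀ X → ∣ X ∣ ≡ d →
   ∀ D D′ → ∣ D ∣ ≡ d → ∣ D′ ∣ ≡ d → D ≢ D′ →
   ∃[ F ] F ∈ 𝓕 × Meets F X × MeetsExactlyOne F D D′)

-- The a-th member is 𝓕_a = { F ∈ 𝓕 : a ∈ F }.
dual : Family n → Fin n → Pred (Subset n) 0ℓ
dual 𝓕 a = 𝓕 ∩ (a Sub.∈_)

unionOver : (Fin n → Pred A 0ℓ) → Subset n → Pred A 0ℓ
unionOver 𝓖 X = ⋃ (∃ (Sub._∈ X)) (𝓖 ∘ proj₁)

UnionFree : ℕ → (Fin n → Pred A 0ℓ) → Set
UnionFree d 𝓖 = ∀ X Y → ∣ X ∣ ≡ d → ∣ Y ∣ ≡ d → X ≢ Y →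
  ¬ (unionOver 𝓖 X ≐ unionOver 𝓖 Y)

-- 𝓖^d. Sets given as predicates are identified up to extensional equality _≐_.
unionsOf : ℕ → (Fin n → Pred A 0ℓ) → Pred (Pred A 0ℓ) 0ℓ
unionsOf d 𝓖 H = ∃[ X ] ∣ X ∣ ≡ d × H ≐ unionOver 𝓖 X

Sperner : Pred (Pred A 0ℓ) 0ℓ → Set₁
Sperner 𝓗 = ∀ H₁ H₂ → H₁ ∈ 𝓗 → H₂ ∈ 𝓗 → ¬ (H₁ ≐ H₂) → ¬ (H₁ ⊆ H₂)

IntersectionCancellative : Pred (Pred A 0ℓ) 0ℓ → Set₁
IntersectionCancellative 𝓗 = ∀ H₁ H₂ H₃ → H₁ ∈ 𝓗 → H₂ ∈ 𝓗 → H₃ ∈ 𝓗 →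
  ¬ (H₁ ≐ H₂) → ¬ (H₁ ≐ H₃) → ¬ (H₂ ≐ H₃) →
  ¬ (H₁ ∩ H₂ ≐ H₁ ∩ H₃)

{-# OPTIONS --safe #-}
-- Write H X = ⋃_{a ∈ X} 𝓕_a, the set of queries in 𝓕 that meet X. The group X
-- tells D from D′ exactly when H X ∩ H D ≠ H X ∩ H D′. For X distinct from D
-- and D′ this is intersection cancellativity, and for X = D it says that
-- H D ⊈ H D′, which is the Sperner property; d-union-freeness translates
-- between distinct sets X and distinct members H X. Separation is the special
-- case X = D.
module Submission where

open import Defs
open import Data.Bool.Properties using () renaming (_≟_ to _≟ᵇ_)
open import Data.Fin.Subset using (Subset; ∣_∣)
open import Data.Fin.Subset.Properties using (anySubset?; nonempty?; x∈p∩q⁺; x∈p∩q⁻)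
open import Data.Nat using (ℕ; _≤_; _∸_)
open import Data.Product using (_×_; _,_; ∃-syntax; proj₁; proj₂)
open import Data.Sum using (inj₁; inj₂)
open import Data.Vec.Properties using (≡-dec)
open import Function.Base using (_∘_)
open import Function.Bundles using (_⇔_; mk⇔)
open import Level using (0ℓ)
open import Relation.Binary.PropositionalEquality using (_≡_; _≢_; refl; sym)
open import Relation.Nullary using (¬_; Dec; yes; no; contradiction; ¬?; _×-dec_; _⊎-dec_; decidable-stable)
open import Relation.Unary using (Decidable; Pred; _∈_; _⊆_; _∩_; _≐_)
open import Relation.Unary.Properties using (≐-refl; ≐-sym; ≐-trans)

private
  variable
    n : ℕ

meets? : (F D : Subset n) → Dec (Meets F D)
meets? F D = nonempty? _

meetsExactlyOne? : (F D D′ : Subset n) → Dec (MeetsExactlyOne F D D′)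
meetsExactlyOne? F D D′ =
  (meets? F D ×-dec ¬? (meets? F D′)) ⊎-dec (¬? (meets? F D) ×-dec meets? F D′)

module _ (𝓕 : Family n) where

  H : Subset n → Pred (Subset n) 0ℓ
  H = unionOver (dual 𝓕)

  Distinguishes : Subset n → Subset n → Subset n → Set
  Distinguishes X D D′ = ∃[ F ] F ∈ 𝓕 × Meets F X × MeetsExactlyOne F D D′

  H⁺ : ∀ {F X} → F ∈ 𝓕 → Meets F X → F ∈ H X
  H⁺ {F} {X} F∈𝓕 (a , a∈F∩X) with a∈F , a∈X ← x∈p∩q⁻ F X a∈F∩X =
    (a , a∈X) , F∈𝓕 , a∈F

  H⁻ : ∀ {F X} → F ∈ H X → F ∈ 𝓕 × Meets F X
  H⁻ ((a , a∈X) , F∈𝓕 , a∈F) = F∈𝓕 , a , x∈p∩q⁺ (a∈F , a∈X)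

  Distinguishes-sym : ∀ {X D D′} → Distinguishes X D D′ → Distinguishes X D′ D
  Distinguishes-sym (F , F∈𝓕 , F∩X , inj₁ (p , q)) = F , F∈𝓕 , F∩X , inj₂ (q , p)
  Distinguishes-sym (F , F∈𝓕 , F∩X , inj₂ (p , q)) = F , F∈𝓕 , F∩X , inj₁ (q , p)

  -- The distinguishing query itself lies in exactly one of the two intersections.
  Distinguishes⇒≭ : ∀ {X D D′} → Distinguishes X D D′ → ¬ (H X ∩ H D ≐ H X ∩ H D′)
  Distinguishes⇒≭ (F , F∈𝓕 , F∩X , inj₁ (F∩D , F∥D′)) (D⊆D′ , _) =
    F∥D′ (proj₂ (H⁻ (proj₂ (D⊆D′ (H⁺ F∈𝓕 F∩X , H⁺ F∈𝓕 F∩D)))))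
  Distinguishes⇒≭ (F , F∈𝓕 , F∩X , inj₂ (F∥D , F∩D′)) (_ , D′⊆D) =
    F∥D (proj₂ (H⁻ (proj₂ (D′⊆D (H⁺ F∈𝓕 F∩X , H⁺ F∈𝓕 F∩D′)))))

  -- A query seen by `X` that meets `D` but misses `D′` would distinguish them. Only this half of
  -- `MeetsExactlyOne` is used here; the reverse inclusion follows by swapping `D` and `D′`.
  ¬Distinguishes⇒⊆ : ∀ {X D D′} → ¬ Distinguishes X D D′ → H X ∩ H D ⊆ H X ∩ H D′
  ¬Distinguishes⇒⊆ {D′ = D′} indist {F} (F∈HX , F∈HD)
    with F∈𝓕 , F∩X ← H⁻ F∈HX | meets? F D′
  ... | yes F∩D′ = F∈HX , H⁺ F∈𝓕 F∩D′
  ... | no  F∥D′ =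
    contradiction (F , F∈𝓕 , F∩X , inj₁ (proj₂ (H⁻ F∈HD) , F∥D′)) indist

  ¬Distinguishes⇒≐ : ∀ {X D D′} → ¬ Distinguishes X D D′ → H X ∩ H D ≐ H X ∩ H D′
  ¬Distinguishes⇒≐ indist =
    ¬Distinguishes⇒⊆ indist , ¬Distinguishes⇒⊆ (indist ∘ Distinguishes-sym)

  -- Allows a witness query to be recovered from the purely negative Sperner and cancellation
  -- hypotheses, by a finite search over all subsets.
  distinguishes? : Decidable 𝓕 → ∀ X D D′ → Dec (Distinguishes X D D′)
  distinguishes? 𝓕? X D D′ =
    anySubset? λ F → 𝓕? F ×-dec meets? F X ×-dec meetsExactlyOne? F D D′

module _ {d : ℕ} {𝓕 : Family n} where

  separating⇒unionFree : Separating d 𝓕 → UnionFree d (dual 𝓕)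
  separating⇒unionFree sep X Y ∣X∣ ∣Y∣ X≢Y (X⊆Y , Y⊆X) with sep X Y ∣X∣ ∣Y∣ X≢Y
  ... | F , F∈𝓕 , inj₁ (F∩X , F∥Y) = F∥Y (proj₂ (H⁻ 𝓕 (X⊆Y (H⁺ 𝓕 F∈𝓕 F∩X))))
  ... | F , F∈𝓕 , inj₂ (F∥X , F∩Y) = F∥X (proj₂ (H⁻ 𝓕 (Y⊆X (H⁺ 𝓕 F∈𝓕 F∩Y))))

  ≭⇒≢ : ∀ {H₁ H₂ : Pred (Subset n) 0ℓ} {X₁ X₂} →
    H₁ ≐ H 𝓕 X₁ → H₂ ≐ H 𝓕 X₂ → ¬ (H₁ ≐ H₂) → X₁ ≢ X₂
  ≭⇒≢ e₁ e₂ H₁≭H₂ refl = H₁≭H₂ (≐-trans e₁ (≐-sym e₂))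

  -- Let `X₁` be both the observers and one candidate: if `H₁ ⊆ H₂`, then both intersections
  -- collapse to `H 𝓕 X₁`.
  solves⇒sperner : SolvesModel2″ d 𝓕 → Sperner (unionsOf d (dual 𝓕))
  solves⇒sperner (_ , solves) H₁ H₂ (X₁ , ∣X₁∣ , e₁) (X₂ , ∣X₂∣ , e₂) H₁≭H₂ H₁⊆H₂ =
    Distinguishes⇒≭ 𝓕 (solves X₁ ∣X₁∣ X₁ X₂ ∣X₁∣ ∣X₂∣ (≭⇒≢ e₁ e₂ H₁≭H₂))
      ( (λ (p , _) → p , proj₁ e₂ (H₁⊆H₂ (proj₂ e₁ p)))
      , (λ (p , _) → p , p))

  -- Here `X₁` observes and the candidates are `X₂` and `X₃`; the equality is carried over to their
  -- representatives along `≐`.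
  solves⇒cancellative : SolvesModel2″ d 𝓕 → IntersectionCancellative (unionsOf d (dual 𝓕))
  solves⇒cancellative (_ , solves) H₁ H₂ H₃
    (X₁ , ∣X₁∣ , f₁ , g₁) (X₂ , ∣X₂∣ , f₂ , g₂) (X₃ , ∣X₃∣ , f₃ , g₃) _ _ H₂≭H₃ (h , h′) =
    Distinguishes⇒≭ 𝓕
      (solves X₁ ∣X₁∣ X₂ X₃ ∣X₂∣ ∣X₃∣ (≭⇒≢ (f₂ , g₂) (f₃ , g₃) H₂≭H₃))
      ( (λ (p , q) → p , f₃ (proj₂ (h  (g₁ p , g₂ q))))
      , (λ (p , q) → p , f₂ (proj₂ (h′ (g₁ p , g₃ q)))))

  -- Union-freeness turns `X ≢ Y` into distinctness of the two unions, which the Sperner property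
  -- asks for.
  unionFree∧sperner⇒⊈ : UnionFree d (dual 𝓕) → Sperner (unionsOf d (dual 𝓕)) →
    ∀ {X Y} → ∣ X ∣ ≡ d → ∣ Y ∣ ≡ d → X ≢ Y → ¬ (H 𝓕 X ⊆ H 𝓕 Y)
  unionFree∧sperner⇒⊈ free sperner {X} {Y} ∣X∣ ∣Y∣ X≢Y =
    sperner _ _ (X , ∣X∣ , ≐-refl) (Y , ∣Y∣ , ≐-refl) (free X Y ∣X∣ ∣Y∣ X≢Y)

  ∩-cancel : UnionFree d (dual 𝓕) → Sperner (unionsOf d (dual 𝓕)) →
    IntersectionCancellative (unionsOf d (dual 𝓕)) →
    ∀ X D D′ → ∣ X ∣ ≡ d → ∣ D ∣ ≡ d → ∣ D′ ∣ ≡ d → D ≢ D′ →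
    ¬ (H 𝓕 X ∩ H 𝓕 D ≐ H 𝓕 X ∩ H 𝓕 D′)
  ∩-cancel free sperner cancel X D D′ ∣X∣ ∣D∣ ∣D′∣ D≢D′ eq@(D⊆D′ , D′⊆D)
    with ≡-dec _≟ᵇ_ X D | ≡-dec _≟ᵇ_ X D′
  -- When the observers are one of the candidates there are no three different members to cancel.
  -- The equality then makes that candidate's union a subset of the other's.
  ... | yes refl | _ =
    unionFree∧sperner⇒⊈ free sperner ∣D∣ ∣D′∣ D≢D′ (λ p → proj₂ (D⊆D′ (p , p)))
  ... | no _ | yes refl =
    unionFree∧sperner⇒⊈ free sperner ∣D′∣ ∣D∣ (D≢D′ ∘ sym) (λ p → proj₂ (D′⊆D (p , p)))
  ... | no X≢D | no X≢D′ =
    cancel _ _ _ (X , ∣X∣ , ≐-refl) (D , ∣D∣ , ≐-refl) (D′ , ∣D′∣ , ≐-refl)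
      (free X D ∣X∣ ∣D∣ X≢D) (free X D′ ∣X∣ ∣D′∣ X≢D′) (free D D′ ∣D∣ ∣D′∣ D≢D′) eq

theorem13 : (n d : ℕ) → 2 ≤ d → d ≤ n ∸ 1 →
    (𝓕 : Family n) → Decidable 𝓕 →
    SolvesModel2″ d 𝓕 ⇔
    (UnionFree d (dual 𝓕) ×
    Sperner (unionsOf d (dual 𝓕)) ×
    IntersectionCancellative (unionsOf d (dual 𝓕)))
theorem13 n d _ _ 𝓕 𝓕? = mk⇔
  (λ s → separating⇒unionFree (proj₁ s) , solves⇒sperner s , solves⇒cancellative s)
  (λ (free , sperner , cancel) →
    let distinguishes X ∣X∣ D D′ ∣D∣ ∣D′∣ D≢D′ =
          -- By contradiction: if no query distinguishes, the intersections agree.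
          decidable-stable (distinguishes? 𝓕 𝓕? X D D′) λ indist →
            ∩-cancel free sperner cancel X D D′ ∣X∣ ∣D∣ ∣D′∣ D≢D′ (¬Distinguishes⇒≐ 𝓕 indist)
        separates X₁ X₂ ∣X₁∣ ∣X₂∣ X₁≢X₂ =
          let F , F∈𝓕 , _ , one = distinguishes X₁ ∣X₁∣ X₁ X₂ ∣X₁∣ ∣X₂∣ X₁≢X₂
          in F , F∈𝓕 , one
    in separates , distinguishes)
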